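{- There exist digraphs $F_1, F_2, \dots$ such that: (i) $\vec{\chi}(F_n) \to \infty$ as $n \to \infty$; (ii) for every $n \geq 1$ and every $v \in V(F_n)$, the neighbourhood $N(v)$ of $v$ in $F_n$ can be partitioned into four sets each inducing a tournament; and (iii) for every $n \geq 1$, $F_n$ contains no cyclic triangle, i.e., no three vertices $u,v,w$ with arcs $uv, vw, wu$.
   Context: All digraphs are finite, loopless, and between any two distinct vertices at most one of the two possible arcs is present. The dichromatic number $\vec{\chi}(D)$ is the least $k$ such that $V(D)$ can be partitioned into $k$ sets each inducing an acyclic subdigraph. The neighbourhood $N(v)$ is the set of vertices $u\ne v$ such that $uv$ or $vu$ is an arc. A tournament is a digraph in which every two distinct vertices are joined by exactly one arc. -}

module Defs where

open import Data.Nat using (ℕ; zero; suc; _≤_)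
open import Data.Fin using (Fin; zero; suc; inject₁; fromℕ)
open import Data.Bool using (Bool; true; false; T)
open import Data.Product using (_×_; Σ; ∃; ∃-syntax; _,_)
open import Data.Sum using (_⊎_)
open import Relation.Binary.PropositionalEquality using (_≡_; _≢_)
open import Relation.Nullary using (¬_)
open import Function.Definitions using (Injective)

record Digraph : Set where
  field
    size      : ℕ
    arc       : Fin size → Fin size → Bool
    loopless  : ∀ u → arc u u ≡ false
    oriented  : ∀ u v → arc u v ≡ true → arc v u ≡ false

module _ (D : Digraph) where
  open Digraph D

  V : Set
  V = Fin size

  Arc : V → V → Set
  Arc u v = T (arc u v)

  Adjacent : V → V → Set
  Adjacent u v = Arc u v ⊎ Arc v u

  InNbhd : V → V → Set
  InNbhd v u = u ≢ v × Adjacent u v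

  record DirectedCycle : Set where
    field
      m       : ℕ
      m≥1     : 1 ≤ m
      c       : Fin (suc m) → V
      c-inj   : Injective _≡_ _≡_ c
      step    : ∀ (i : Fin m) → Arc (c (inject₁ i)) (c (suc i))
      closing : Arc (c (fromℕ m)) (c zero)

  InducesAcyclic : (V → Set) → Set
  InducesAcyclic S = ¬ (Σ DirectedCycle λ C → ∀ i → S (DirectedCycle.c C i))

  -- V(D) can be partitioned into k sets each inducing an acyclic subdigraph
  -- (colour classes of col; empty classes allowed). Thus
  -- dichromatic number ≤ k  ⇔  DiColourable k.
  DiColourable : ℕ → Set
  DiColourable k = Σ (V → Fin k) λ col →
    ∀ (j : Fin k) → InducesAcyclic (λ u → col u ≡ j)

  -- N(v) can be partitioned into four sets each inducing a tournament:
  -- an assignment p of the neighbours of v to four parts such that any two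
  -- distinct neighbours in the same part are adjacent. (p is given on all of V,
  -- only its values on N(v) matter.)
  NbhdFourTournaments : V → Set
  NbhdFourTournaments v = Σ (V → Fin 4) λ p →
    ∀ u w → InNbhd v u → InNbhd v w → p u ≡ p w → u ≢ w → Adjacent u w

  HasCyclicTriangle : Set
  HasCyclicTriangle = ∃[ u ] ∃[ v ] ∃[ w ] (Arc u v × Arc v w × Arc w u)

{-# OPTIONS --safe #-}

-- Take the q³ points of a three-dimensional grid and lines in four directions, any three of them
-- linearly independent, so that there are no triangles of lines. Label every point, once for each
-- direction, by an element of a set of size B, and orient each line into a transitive tournament by
-- increasing labels: (ii) and (iii) then hold for every labelling. If such a digraph is k-colourable,
-- its labelling can be recovered from the colouring, the ranks of the points in the acyclic colour
-- classes, and, for each line, colour and label b, the least rank of a point of that colour on that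
-- line with label above b. There are about (k q³)^(q³) colourings with ranks, and for q much larger
-- than k B only q^(o(q³)) families of thresholds, against B^(4 q³) labellings; with B close to q most
-- labellings are therefore not k-colourable.
module Submission where

open import Defs
open import Data.Nat
  using (ℕ; zero; suc; _+_; _*_; _^_; _≤_; _<_; z≤n; s≤s; s≤s⁻¹; z<s; NonZero; >-nonZero; _≤?_)
open import Data.Nat.Properties
open import Data.Nat.Tactic.RingSolver using (solve-∀)
open import Data.Fin
  using (Fin; zero; suc; toℕ; fromℕ<; inject₁; _↑ˡ_; combine; remQuot; finToFun; funToFin)
import Data.Fin as Fin
import Data.Fin.Properties as Fin
open import Data.Fin.Patterns using (0F; 1F; 2F; 3F)
open import Data.Fin.Relation.Unary.Top using (view; ‵fromℕ; ‵inject₁)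
open import Data.Bool using (T)
open import Data.Bool.Properties using (T?; T-≡)
open import Data.Product using (Σ; ∃; ∃₂; _×_; _,_; proj₁; proj₂; map)
open import Data.Sum using (_⊎_; inj₁; inj₂)
open import Data.Empty using (⊥; ⊥-elim)
open import Data.Unit using (⊤; tt)
open import Function using (_∘_; Equivalence)
open import Function.Definitions using (Injective)
open import Relation.Nullary using (¬_; Dec; yes; no; does; contradiction)
open import Relation.Nullary.Decidable
  using (True; False; fromWitness; fromWitnessFalse; dec-true; dec-false; ¬?; _×-dec_; _→-dec_)
open import Relation.Unary using (Decidable)
open import Relation.Binary using (tri<; tri≈; tri>)
open import Relation.Binary.PropositionalEquality
open import Algebra.Properties.CommutativeSemigroup +-commutativeSemigroup using (x∙yz≈y∙xz)

-- Counting estimates.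

-- The factor next to 16 counts the quadruples of direction, line, colour and label; at
-- `q = 128 * k * B` the right-hand side is the number of points.
cube-size : ∀ k q B → 16 * (4 * (q * (q + q)) * k * B) ≡ q * (q * (128 * k * B))
cube-size = solve-∀

-- M is the number of points and N the number of thresholds. After bounding k by c and M + 1 by c ^ 25,
-- the exponents of c on the two sides are 441 N and 448 N.
codes<labellings : ∀ k c M N → 1 ≤ k → k < c → M ≡ c ^ 24 → M ≡ 16 * N →
  k ^ M * (suc M ^ M * suc M ^ N) < (c ^ 7) ^ (4 * M)
codes<labellings k c M N 1≤k k<c M≡c²⁴ M≡16N = begin-strict
  k ^ M * (suc M ^ M * suc M ^ N)
    ≤⟨ *-mono-≤ (^-monoˡ-≤ M (<⇒≤ k<c)) (*-mono-≤ (^-monoˡ-≤ M 1+M≤c²⁵) (^-monoˡ-≤ N 1+M≤c²⁵)) ⟩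
  c ^ M * ((c ^ 25) ^ M * (c ^ 25) ^ N)
    ≡⟨ cong₂ (λ x y → c ^ M * (x * y)) (^-*-assoc c 25 M) (^-*-assoc c 25 N) ⟩
  c ^ M * (c ^ (25 * M) * c ^ (25 * N))
    ≡⟨ cong (c ^ M *_) (^-distribˡ-+-* c (25 * M) (25 * N)) ⟨
  c ^ M * c ^ (25 * M + 25 * N)
    ≡⟨ ^-distribˡ-+-* c M (25 * M + 25 * N) ⟨
  c ^ (M + (25 * M + 25 * N))
    <⟨ ^-monoʳ-< c 1<c exponents ⟩
  c ^ (7 * (4 * M))
    ≡⟨ ^-*-assoc c 7 (4 * M) ⟨
  (c ^ 7) ^ (4 * M) ∎
  where
  open ≤-Reasoning
  1<c : 1 < c
  1<c = ≤-<-trans 1≤k k<c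
  instance
    c≢0 : NonZero c
    c≢0 = >-nonZero (<-trans z<s 1<c)
  0<M : 0 < M
  0<M = subst (0 <_) (sym M≡c²⁴) (m^n>0 c 24)
  0<N : ∀ N → M ≡ 16 * N → 0 < N
  0<N zero    M≡0 = subst (0 <_) M≡0 0<M
  0<N (suc N) _   = z<s
  1+M≤c²⁵ : suc M ≤ c ^ 25
  1+M≤c²⁵ = begin
    1 + M    ≤⟨ +-monoˡ-≤ M 0<M ⟩
    M + M    ≡⟨ cong (M +_) (+-identityʳ M) ⟨
    2 * M    ≤⟨ *-mono-≤ 1<c (≤-reflexive M≡c²⁴) ⟩
    c * c ^ 24 ∎
  left : ∀ N → 16 * N + (25 * (16 * N) + 25 * N) ≡ 441 * N
  left = solve-∀
  right : ∀ N → 7 * (4 * (16 * N)) ≡ 448 * N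
  right = solve-∀
  exponents : M + (25 * M + 25 * N) < 7 * (4 * M)
  exponents = begin-strict
    M + (25 * M + 25 * N) ≡⟨ cong (λ x → x + (25 * x + 25 * N)) M≡16N ⟩
    16 * N + (25 * (16 * N) + 25 * N) ≡⟨ left N ⟩
    441 * N <⟨ *-monoˡ-< N {{>-nonZero (0<N N M≡16N)}} (m≤m+n 442 6) ⟩
    448 * N ≡⟨ right N ⟨
    7 * (4 * (16 * N)) ≡⟨ cong (λ x → 7 * (4 * x)) M≡16N ⟨
    7 * (4 * M) ∎

-- Ranks in acyclic colour classes.

-- The least `s < n` satisfying the upward closed `Q`, with `n` standing for none.
threshold : {Q : ℕ → Set} → Decidable Q → (∀ {s} → Q s → Q (suc s)) → ∀ n →
  Σ (Fin (suc n)) λ t → ∀ s → s < n → (toℕ t ≤ s → Q s) × (Q s → toℕ t ≤ s)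
threshold Q? up zero = zero , λ _ ()
threshold {Q} Q? up (suc n) with Q? 0
... | yes Q0 = zero , λ s _ → (λ _ → all s) , (λ _ → z≤n)
  where
  all : ∀ s → Q s
  all zero    = Q0
  all (suc s) = up (all s)
... | no ¬Q0 with threshold {Q ∘ suc} (Q? ∘ suc) up n
...   | t , t-spec = suc t , λ where
  zero    _   → (λ ()) , ⊥-elim ∘ ¬Q0
  (suc s) s<n → proj₁ (t-spec s (s≤s⁻¹ s<n)) ∘ s≤s⁻¹ , s≤s ∘ proj₂ (t-spec s (s≤s⁻¹ s<n))

module _ (D : Digraph) {k : ℕ} (col : V D → Fin k)
         (acyclic : ∀ j → InducesAcyclic D (λ u → col u ≡ j)) where
  open Digraph D using (size; arc; loopless)

  Arcᶜ : V D → V D → Set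
  Arcᶜ u v = Arc D u v × col u ≡ col v

  Arcᶜ-irrefl : ∀ u → ¬ Arcᶜ u u
  Arcᶜ-irrefl u (u→u , _) = subst T (loopless u) u→u

  record Path (m : ℕ) : Set where
    field
      c     : Fin (suc m) → V D
      c-inj : Injective _≡_ _≡_ c
      step  : ∀ i → Arcᶜ (c (inject₁ i)) (c (suc i))

  open Path

  init : ∀ {m} → Path (suc m) → Path m
  init P = record
    { c     = c P ∘ inject₁
    ; c-inj = Fin.inject₁-injective ∘ c-inj P
    ; step  = step P ∘ inject₁
    }

  constant : ∀ {m} (P : Path m) i → col (c P i) ≡ col (c P zero)
  constant         P zero    = refl
  constant {suc m} P (suc i) = trans (sym (proj₂ (step P i))) (constant (init P) i)

  -- An arc back from the last vertex closes a monochromatic cycle, or is a loop if the path is a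
  -- single vertex; any other vertex is the last one of a shorter initial path.
  no-back-arc : ∀ {m} (P : Path m) j → ¬ Arcᶜ (c P j) (c P zero)
  no-back-arc {m} P j back with view j
  no-back-arc {zero}  P _ back | ‵fromℕ = Arcᶜ-irrefl _ back
  no-back-arc {suc m} P _ back | ‵fromℕ = acyclic (col (c P zero)) (cycle , constant P)
    where
    cycle : DirectedCycle D
    cycle = record
      { m = suc m ; m≥1 = s≤s z≤n ; c = c P ; c-inj = c-inj P
      ; step = proj₁ ∘ step P ; closing = proj₁ back }
  no-back-arc {suc m} P _ back | ‵inject₁ i = no-back-arc (init P) i back

  cons : ∀ {m} (P : Path m) u → Arcᶜ u (c P zero) → Path (suc m)
  cons {m} P u u→P = record { c = c′ ; c-inj = inj _ _ ; step = step′ }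
    where
    c′ : Fin (suc (suc m)) → V D
    c′ zero    = u
    c′ (suc i) = c P i
    fresh : ∀ i → u ≢ c P i
    fresh i refl = no-back-arc P i u→P
    inj : ∀ i j → c′ i ≡ c′ j → i ≡ j
    inj zero    zero    _  = refl
    inj zero    (suc j) eq = ⊥-elim (fresh j eq)
    inj (suc i) zero    eq = ⊥-elim (fresh i (sym eq))
    inj (suc i) (suc j) eq = cong suc (c-inj P eq)
    step′ : ∀ i → Arcᶜ (c′ (inject₁ i)) (c′ (suc i))
    step′ zero    = u→P
    step′ (suc i) = step P i

  -- Vertices may repeat, which makes existence decidable by recursion on the length; acyclicity
  -- later turns walks into paths.
  WalkTo : ℕ → V D → Set
  WalkTo zero    v = ⊤
  WalkTo (suc t) v = ∃ λ u → Arcᶜ u v × WalkTo t u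

  walkTo? : ∀ t → Decidable (WalkTo t)
  walkTo? zero    v = yes tt
  walkTo? (suc t) v =
    Fin.any? λ u → (T? (arc u v) ×-dec (col u Fin.≟ col v)) ×-dec walkTo? t u

  walkTo-pred : ∀ t {v} → WalkTo (suc t) v → WalkTo t v
  walkTo-pred zero    _           = tt
  walkTo-pred (suc t) (u , a , w) = u , a , walkTo-pred t w

  prepend : ∀ t {m} (P : Path m) → WalkTo t (c P zero) → Path (t + m)
  prepend zero    P _ = P
  prepend (suc t) {m} P (u , a , w) = subst Path (+-suc t m) (prepend t (cons P u a) w)

  -- Such a walk would be a path on `suc size` distinct vertices.
  no-long-walk : ∀ v → ¬ WalkTo size v
  no-long-walk v w = Fin.<⇒notInjective (s≤s (m≤m+n size 0)) (c-inj (prepend size start w))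
    where
    start : Path 0
    start = record { c = λ _ → v ; c-inj = λ { {zero} {zero} _ → refl } ; step = λ () }

  rank-spec : ∀ v → Σ (Fin (suc size)) λ r → ∀ s → s < size →
    (toℕ r ≤ s → ¬ WalkTo (suc s) v) × (¬ WalkTo (suc s) v → toℕ r ≤ s)
  rank-spec v = threshold (λ s → ¬? (walkTo? (suc s) v)) (_∘ walkTo-pred _) size

  -- The length of a longest monochromatic walk ending at v.
  rank : V D → Fin (suc size)
  rank v = proj₁ (rank-spec v)

  rank<size : ∀ v → toℕ (rank v) < size
  rank<size v = bound size ≤-refl v (no-long-walk v) refl
    where
    -- `size` is generalised to `n` so that it can be split; the vertex in `Fin n` excludes zero.
    bound : ∀ n → n ≤ size → Fin n → ¬ WalkTo n v → n ≡ size → toℕ (rank v) < n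
    bound (suc n) n<size _ ¬w _ = s≤s (proj₂ (proj₂ (rank-spec v) n n<size) ¬w)

  -- A longest walk to `u` extends along the arc to a longer walk to `v`.
  rank-mono : ∀ {u v} → Arcᶜ u v → toℕ (rank u) < toℕ (rank v)
  rank-mono {u} {v} a = ≰⇒> λ rv≤ru →
    no-walk (toℕ (rank u)) ≤-refl (rank<size u) λ w →
      proj₁ (proj₂ (rank-spec v) (toℕ (rank u)) (rank<size u)) rv≤ru (u , a , w)
    where
    -- The specification of `rank` speaks of absent walks, so a walk to `u` is obtained only up to
    -- double negation, which suffices here.
    no-walk : ∀ s → s ≤ toℕ (rank u) → s < size → ¬ ¬ WalkTo s u
    no-walk zero    _    _    ¬w = ¬w tt
    no-walk (suc s) s<ru s<n ¬w =
      <-irrefl refl (<-≤-trans s<ru (proj₂ (proj₂ (rank-spec u) s (<-trans (n<1+n s) s<n)) ¬w))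

-- Finite codes and the pigeonhole principle.

finToFun-injective : ∀ {m n} (x y : Fin (m ^ n)) →
  (∀ i → finToFun {m} {n} x i ≡ finToFun y i) → x ≡ y
finToFun-injective {m} {n} x y x≗y =
  trans (sym (Fin.funToFin-finToFin {n} {m} x))
    (trans (funToFin-cong x≗y) (Fin.funToFin-finToFin {n} {m} y))
  where
  funToFin-cong : ∀ {m n} {f g : Fin n → Fin m} → (∀ i → f i ≡ g i) → funToFin f ≡ funToFin g
  funToFin-cong {n = zero}  f≗g = refl
  funToFin-cong {n = suc n} f≗g = cong₂ combine (f≗g zero) (funToFin-cong (f≗g ∘ suc))

-- This is what lets a label be recovered from threshold comparisons.
<-injective : ∀ {n} {i j : Fin n} → (∀ b → (b Fin.< i → b Fin.< j) × (b Fin.< j → b Fin.< i)) → i ≡ j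
<-injective {i = i} {j} same with Fin.<-cmp i j
... | tri< i<j _ _ = contradiction (proj₂ (same i) i<j) (<-irrefl refl)
... | tri≈ _ i≡j _ = i≡j
... | tri> _ _ j<i = contradiction (proj₁ (same j) j<i) (<-irrefl refl)

uncoded : ∀ {m n} {R : Fin n → Fin m → Set} → (∀ x c → Dec (R x c)) →
  (∀ {x y c} → R x c → R y c → x ≡ y) → m < n → ∃ λ x → ∀ c → ¬ R x c
uncoded {n = n} {R} R? functional m<n =
  let x , ¬Rx = Fin.¬∀⟶∃¬ n (λ x → ∃ (R x)) (λ x → Fin.any? (R? x)) not-all-coded
  in x , λ c Rxc → ¬Rx (c , Rxc)
  where
  not-all-coded : ¬ (∀ x → ∃ (R x))
  not-all-coded coded = Fin.<⇒notInjective m<n λ {x} {y} eq →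
    functional (proj₂ (coded x)) (subst (R y) (sym eq) (proj₂ (coded y)))

onPairs : ∀ {m n} {A : Set} → (Fin m → Fin n → A) → Fin (m * n) → A
onPairs {m} {n} f i = let j , k = remQuot {m} n i in f j k

onPairs-combine : ∀ {m n} {A : Set} (f : Fin m → Fin n → A) j k → onPairs f (combine j k) ≡ f j k
onPairs-combine f j k = cong (λ (j , k) → f j k) (Fin.remQuot-combine j k)

split³ : ∀ {l m n} → Fin (l * (m * n)) → Fin l × Fin m × Fin n
split³ = onPairs λ i → onPairs λ j k → i , j , k

split³-combine : ∀ {l m n} (i : Fin l) (j : Fin m) (k : Fin n) →
  split³ (combine i (combine j k)) ≡ (i , j , k)
split³-combine i j k = trans
  (onPairs-combine (λ i → onPairs λ j k → i , j , k) i (combine j k))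
  (onPairs-combine (λ j k → i , j , k) j k)

T-does⇒ : {A : Set} (A? : Dec A) → T (does A?) → A
T-does⇒ (yes a) _ = a

-- The digraph of a labelled net of lines.

-- Instances of no-triangle with r ≡ s and a ≡ b say that two lines meet in at most one point.
module LabelledNet {M Λ : ℕ} (ℓ : Fin 4 → Fin M → Fin Λ)
  (no-triangle : ∀ {a b c p r s} → a ≢ c → b ≢ c →
    ℓ a p ≡ ℓ a r → ℓ b r ≡ ℓ b s → ℓ c s ≡ ℓ c p → s ≡ p)
  {B : ℕ} where

  Labelling : Set
  Labelling = Fin 4 → Fin M → Fin B

  module _ (h : Labelling) where

    -- Ties between labels are broken by the index of the point.
    key : Fin 4 → Fin M → Fin (B * M)
    key d u = combine (h d u) u

    Before : Fin 4 → Fin M → Fin M → Set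
    Before d u v = ℓ d u ≡ ℓ d v × key d u Fin.< key d v

    before? : ∀ u v → Dec (∃ λ d → Before d u v)
    before? u v = Fin.any? λ d → (ℓ d u Fin.≟ ℓ d v) ×-dec (key d u Fin.<? key d v)

    Before-irrefl : ∀ {d u} → ¬ Before d u u
    Before-irrefl (_ , u<u) = <-irrefl refl u<u

    Before⇒≢ : ∀ {d u v} → Before d u v → u ≢ v
    Before⇒≢ b refl = Before-irrefl b

    Before-total : ∀ d {u v} → ℓ d u ≡ ℓ d v → u ≢ v → Before d u v ⊎ Before d v u
    Before-total d {u} {v} eq u≢v with Fin.<-cmp (key d u) (key d v)
    ... | tri< u<v _ _ = inj₁ (eq , u<v)
    ... | tri≈ _ u≡v _ = contradiction (Fin.combine-injectiveʳ (h d u) u (h d v) v u≡v) u≢v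
    ... | tri> _ _ v<u = inj₂ (sym eq , v<u)

    -- If one direction differs from the other two, rotating it into third place contradicts
    -- `no-triangle`; otherwise all three agree and the keys increase around the cycle.
    Before-acyclic : ∀ {a b c u v w} → Before a u v → Before b v w → Before c w u → ⊥
    Before-acyclic {a} {b} {c} u<v@(uv , _) v<w@(vw , _) w<u@(wu , _) with a Fin.≟ c | b Fin.≟ c
    ... | no a≢c   | no b≢c   = Before⇒≢ w<u (no-triangle a≢c b≢c uv vw wu)
    ... | yes refl | no b≢c   = Before⇒≢ v<w (no-triangle (≢-sym b≢c) (≢-sym b≢c) wu uv vw)
    ... | no a≢c   | yes refl = Before⇒≢ u<v (no-triangle (≢-sym a≢c) (≢-sym a≢c) vw wu uv)
    ... | yes refl | yes refl =
      <-irrefl refl (<-trans (<-trans (proj₂ u<v) (proj₂ v<w)) (proj₂ w<u))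

    Before-asym : ∀ {a b u v} → Before a u v → Before b v u → ⊥
    Before-asym {a} {b} u<v@(uv , _) v<u@(vu , _) with a Fin.≟ b
    ... | no a≢b   = Before⇒≢ v<u (no-triangle a≢b a≢b uv refl vu)
    ... | yes refl = <-irrefl refl (<-trans (proj₂ u<v) (proj₂ v<u))

    digraph : Digraph
    digraph = record
      { size     = M
      ; arc      = λ u v → does (before? u v)
      ; loopless = λ u → dec-false (before? u u) (Before-irrefl ∘ proj₂)
      ; oriented = λ u v uv → dec-false (before? v u) λ (_ , v<u) →
          Before-asym (proj₂ (T-does⇒ (before? u v) (Equivalence.from T-≡ uv))) v<u
      }

    arc⇒before : ∀ {u v} → Arc digraph u v → ∃ λ d → Before d u v
    arc⇒before {u} {v} = T-does⇒ (before? u v)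

    before⇒arc : ∀ {d u v} → Before d u v → Arc digraph u v
    before⇒arc {d} {u} {v} u<v = Equivalence.from T-≡ (dec-true (before? u v) (d , u<v))

    no-cyclic-triangle : ¬ HasCyclicTriangle digraph
    no-cyclic-triangle (u , v , w , uv , vw , wu) =
      Before-acyclic (proj₂ (arc⇒before uv)) (proj₂ (arc⇒before vw)) (proj₂ (arc⇒before wu))

    collinear : ∀ {u v} → Adjacent digraph u v → ∃ λ d → ℓ d u ≡ ℓ d v
    collinear (inj₁ uv) with d , eq , _ ← arc⇒before uv = d , eq
    collinear (inj₂ vu) with d , eq , _ ← arc⇒before vu = d , sym eq

    -- The parts come from the four lines through `v`, each totally ordered by its keys.
    four-tournaments : ∀ v → NbhdFourTournaments digraph v
    four-tournaments v = part , tournament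
      where
      collinear? : ∀ u → Dec (∃ λ d → ℓ d u ≡ ℓ d v)
      collinear? u = Fin.any? λ d → ℓ d u Fin.≟ ℓ d v

      direction : ∀ {u} → Dec (∃ λ d → ℓ d u ≡ ℓ d v) → Fin 4
      direction (yes (d , _)) = d
      -- A default for points that are not collinear with `v`, hence not neighbours.
      direction (no _)        = zero

      part : Fin M → Fin 4
      part u = direction (collinear? u)

      on-part-line : ∀ {u} → InNbhd digraph v u → ℓ (part u) u ≡ ℓ (part u) v
      on-part-line {u} (_ , adj) with collinear? u
      ... | yes (_ , eq) = eq
      ... | no ¬line     = contradiction (collinear adj) ¬line

      tournament : ∀ u w → InNbhd digraph v u → InNbhd digraph v w → part u ≡ part w → u ≢ w →
        Adjacent digraph u w
      tournament u w vu vw same u≢w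
        with Before-total (part u) (trans (on-part-line vu) (sym w-on-line)) u≢w
        where
        w-on-line : ℓ (part u) w ≡ ℓ (part u) v
        w-on-line = subst (λ d → ℓ d w ≡ ℓ d v) (sym same) (on-part-line vw)
      ... | inj₁ u<w = inj₁ (before⇒arc u<w)
      ... | inj₂ w<u = inj₂ (before⇒arc w<u)

  -- Recovering labellings from colourings.

  module _ {k : ℕ} where

    -- The value M, which exceeds every rank, stands for the minimum of the empty set.
    Thresholds : Set
    Thresholds = Fin 4 → Fin Λ → Fin k → Fin B → Fin (suc M)

    -- For fixed `col`, `L` and `τ`, this prescribes the set of labels below each `h d p`, and so
    -- `h` itself.
    Fits : Labelling → (Fin M → Fin k) → (Fin M → Fin (suc M)) → Thresholds → Set
    Fits h col L τ = ∀ d p b →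
      (b Fin.< h d p → τ d (ℓ d p) (col p) b Fin.≤ L p) ×
      (τ d (ℓ d p) (col p) b Fin.≤ L p → b Fin.< h d p)

    fits? : ∀ h col L τ → Dec (Fits h col L τ)
    fits? h col L τ = Fin.all? λ d → Fin.all? λ p → Fin.all? λ b →
      ((b Fin.<? h d p) →-dec (τ d (ℓ d p) (col p) b Fin.≤? L p)) ×-dec
      ((τ d (ℓ d p) (col p) b Fin.≤? L p) →-dec (b Fin.<? h d p))

    fits-functional : ∀ {h h′ col L τ} → Fits h col L τ → Fits h′ col L τ → ∀ d p → h d p ≡ h′ d p
    fits-functional fit fit′ d p = <-injective λ b →
      proj₂ (fit′ d p b) ∘ proj₁ (fit d p b) , proj₂ (fit d p b) ∘ proj₁ (fit′ d p b)

    -- Decoded functions agree with the encoded ones only pointwise.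
    fits-resp : ∀ {h col col′ L L′} {τ τ′ : Thresholds} →
      (∀ p → col p ≡ col′ p) → (∀ p → L p ≡ L′ p) → (∀ d l c b → τ d l c b ≡ τ′ d l c b) →
      Fits h col L τ → Fits h col′ L′ τ′
    fits-resp {col = col} {τ = τ} col≗ L≗ τ≗ fit d p b
      rewrite sym (col≗ p) | sym (L≗ p) | sym (τ≗ d (ℓ d p) (col p) b) = fit d p b

    colouring-fits : ∀ h (col : Fin M → Fin k) →
      (∀ j → InducesAcyclic (digraph h) (λ u → col u ≡ j)) → ∃₂ λ L τ → Fits h col L τ
    colouring-fits h col acyclic = L , τ , fits
      where
      D = digraph h
      L = rank D col acyclic

      -- The threshold of `Q d l c b` is the least rank among points of colour `c` on line `l` with
      -- label above `b`.
      Q : Fin 4 → Fin Λ → Fin k → Fin B → ℕ → Set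
      Q d l c b s = ∃ λ p → (ℓ d p ≡ l × col p ≡ c) × (b Fin.< h d p × toℕ (L p) ≤ s)

      τ-spec : ∀ d l c b → Σ (Fin (suc M)) λ t → ∀ s → s < M →
        (toℕ t ≤ s → Q d l c b s) × (Q d l c b s → toℕ t ≤ s)
      τ-spec d l c b = threshold
        (λ s → Fin.any? λ p → ((ℓ d p Fin.≟ l) ×-dec (col p Fin.≟ c)) ×-dec
                              ((b Fin.<? h d p) ×-dec (toℕ (L p) ≤? s)))
        (λ (p , on , b< , ≤s) → p , on , b< , m≤n⇒m≤1+n ≤s) M

      τ : Thresholds
      τ d l c b = proj₁ (τ-spec d l c b)

      -- A smaller label at `p` would give a monochromatic arc from `p` to `r`, forcing a larger
      -- rank at `r`.
      label-mono : ∀ d p r → ℓ d p ≡ ℓ d r → col p ≡ col r → toℕ (L r) ≤ toℕ (L p) →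
        h d r Fin.≤ h d p
      label-mono d p r pr same Lr≤Lp = ≮⇒≥ λ hp<hr →
        <⇒≱ (rank-mono D col acyclic
          (before⇒arc h (pr , Fin.combine-monoˡ-< p r hp<hr) , same)) Lr≤Lp

      fits : Fits h col L τ
      fits d p b = below , above
        where
        -- Ranks are strictly below `M`, so none is confused with the value for the empty set.
        spec = proj₂ (τ-spec d (ℓ d p) (col p) b) (toℕ (L p)) (rank<size D col acyclic p)
        below : b Fin.< h d p → τ d (ℓ d p) (col p) b Fin.≤ L p
        below b<h = proj₂ spec (p , (refl , refl) , b<h , ≤-refl)
        above : τ d (ℓ d p) (col p) b Fin.≤ L p → b Fin.< h d p
        above τ≤L with r , (rp , same) , b<hr , Lr≤Lp ← proj₁ spec τ≤L =
          <-≤-trans b<hr (label-mono d p r (sym rp) (sym same) Lr≤Lp)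

    indices codes : ℕ
    indices = 4 * Λ * k * B
    codes   = k ^ M * (suc M ^ M * suc M ^ indices)

    index : Fin 4 → Fin Λ → Fin k → Fin B → Fin indices
    index d l j b = combine (combine (combine d l) j) b

    flatten : Thresholds → Fin indices → Fin (suc M)
    flatten = onPairs ∘ onPairs ∘ onPairs

    flatten-index : ∀ τ d l j b → flatten τ (index d l j b) ≡ τ d l j b
    flatten-index τ d l j b =
      trans (onPairs-combine (onPairs (onPairs τ)) (combine (combine d l) j) b)
        (trans (cong (λ f → f b) (onPairs-combine (onPairs τ) (combine d l) j))
          (cong (λ f → f j b) (onPairs-combine τ d l)))

    labelling : Fin (B ^ (4 * M)) → Labelling
    labelling x d p = finToFun x (combine d p)

    labelling-injective : ∀ x y → (∀ d p → labelling x d p ≡ labelling y d p) → x ≡ y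
    labelling-injective x y same = finToFun-injective x y pointwise
      where
      pointwise : ∀ i → finToFun {B} {4 * M} x i ≡ finToFun y i
      pointwise i with d , p , refl ← Fin.combine-surjective {4} {M} i = same d p

    encode : (Fin M → Fin k) → (Fin M → Fin (suc M)) → Thresholds → Fin codes
    encode col L τ = combine (funToFin col) (combine (funToFin L) (funToFin (flatten τ)))

    FitsParts : Labelling → Fin (k ^ M) × Fin (suc M ^ M) × Fin (suc M ^ indices) → Set
    FitsParts h (x , y , z) =
      Fits h (finToFun x) (finToFun y) (λ d l j b → finToFun z (index d l j b))

    FitsCode : Labelling → Fin codes → Set
    FitsCode h c = FitsParts h (split³ c)

    fits-encode : ∀ h col L τ → Fits h col L τ → FitsCode h (encode col L τ)
    fits-encode h col L τ fit =
      subst (FitsParts h) (sym (split³-combine (funToFin col) (funToFin L) (funToFin (flatten τ))))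
        (fits-resp {h} {τ = τ}
          (sym ∘ Fin.finToFun-funToFin col)
          (sym ∘ Fin.finToFun-funToFin L)
          (λ d l j b → sym (trans (Fin.finToFun-funToFin (flatten τ) (index d l j b))
                                  (flatten-index τ d l j b)))
          fit)

    fitsCode? : ∀ h c → Dec (FitsCode h c)
    fitsCode? h c =
      let x , y , z = split³ c
      in fits? h (finToFun x) (finToFun y) (λ d l j b → finToFun z (index d l j b))

    fitsCode-functional : ∀ {h h′} c → FitsCode h c → FitsCode h′ c → ∀ d p → h d p ≡ h′ d p
    fitsCode-functional {h} {h′} c =
      let x , y , z = split³ c
      in fits-functional {h} {h′} {finToFun x} {finToFun y} {λ d l j b → finToFun z (index d l j b)}

    uncolourable : codes < B ^ (4 * M) → ∃ λ h → ¬ DiColourable (digraph h) k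
    uncolourable codes<labellings =
      let x , unfit = uncoded {R = FitsCode ∘ labelling} (fitsCode? ∘ labelling)
            (λ {x} {y} {c} fx fy → labelling-injective x y (fitsCode-functional c fx fy))
            codes<labellings
      in labelling x , λ (col , acyclic) →
        let L , τ , fit = colouring-fits (labelling x) col acyclic
        in unfit (encode col L τ) (fits-encode (labelling x) col L τ fit)

-- The grid and its four directions.

-- In the coordinates (x, t, z) the four directions are (1,0,0), (0,1,0), (0,1,-1) and (1,0,-1): with
-- this basis the lines are level sets of linear forms with nonnegative coefficients.
module Grid (q : ℕ) where

  Point : Set
  Point = Fin (q * (q * q))

  coordinates : Point → Fin q × Fin q × Fin q
  coordinates p = let x , ty = remQuot {q} (q * q) p in x , remQuot {q} q ty

  coordinates-injective : ∀ p r → coordinates p ≡ coordinates r → p ≡ r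
  coordinates-injective p r eq = begin
    p ≡⟨ join p ⟨
    (let x , t , z = coordinates p in combine x (combine t z))
      ≡⟨ cong (λ (x , t , z) → combine x (combine t z)) eq ⟩
    (let x , t , z = coordinates r in combine x (combine t z)) ≡⟨ join r ⟩
    r ∎
    where
    open ≡-Reasoning
    join : ∀ p → (let x , t , z = coordinates p in combine x (combine t z)) ≡ p
    join p = trans
      (cong (combine (proj₁ (remQuot {q} (q * q) p))) (Fin.combine-remQuot {q} q _))
      (Fin.combine-remQuot {q} (q * q) p)

  x t z : Point → ℕ
  x = toℕ ∘ proj₁ ∘ coordinates
  t = toℕ ∘ proj₁ ∘ proj₂ ∘ coordinates
  z = toℕ ∘ proj₂ ∘ proj₂ ∘ coordinates

  xtz-injective : ∀ {p r} → x p ≡ x r → t p ≡ t r → z p ≡ z r → p ≡ r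
  xtz-injective {p} {r} x≡ t≡ z≡ = coordinates-injective p r
    (cong₂ _,_ (Fin.toℕ-injective x≡) (cong₂ _,_ (Fin.toℕ-injective t≡) (Fin.toℕ-injective z≡)))

  -- Sums of two coordinates need the range `q + q`; `wide` pads single coordinates so that all
  -- directions share one index set.
  line : Fin 4 → Point → Fin (q * (q + q))
  line d p = let x , t , z = coordinates p in line′ d x t z
    where
    wide : Fin q → Fin (q + q)
    wide = _↑ˡ q
    _⊕_ : Fin q → Fin q → Fin (q + q)
    i ⊕ j = fromℕ< (+-mono-< (Fin.toℕ<n i) (Fin.toℕ<n j))
    line′ : Fin 4 → Fin q → Fin q → Fin q → Fin (q * (q + q))
    line′ 0F x t z = combine t (wide z)
    line′ 1F x t z = combine x (wide z)
    line′ 2F x t z = combine x (t ⊕ z)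
    line′ 3F x t z = combine t (x ⊕ z)

  SameLine : Fin 4 → Point → Point → Set
  SameLine 0F p r = t p ≡ t r × z p ≡ z r
  SameLine 1F p r = x p ≡ x r × z p ≡ z r
  SameLine 2F p r = x p ≡ x r × t p + z p ≡ t r + z r
  SameLine 3F p r = t p ≡ t r × x p + z p ≡ x r + z r

  sameLine : ∀ d {p r} → line d p ≡ line d r → SameLine d p r
  sameLine 0F = map (cong toℕ) (cong toℕ ∘ Fin.↑ˡ-injective q _ _) ∘ Fin.combine-injective _ _ _ _
  sameLine 1F = map (cong toℕ) (cong toℕ ∘ Fin.↑ˡ-injective q _ _) ∘ Fin.combine-injective _ _ _ _
  sameLine 2F = map (cong toℕ) (Fin.fromℕ<-injective _ _ _ _) ∘ Fin.combine-injective _ _ _ _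
  sameLine 3F = map (cong toℕ) (Fin.fromℕ<-injective _ _ _ _) ∘ Fin.combine-injective _ _ _ _

  +-cancelʳ′ : ∀ {i j k l} → i + k ≡ j + l → k ≡ l → i ≡ j
  +-cancelʳ′ {i} {j} {k} eq refl = +-cancelʳ-≡ k i j eq

  +-cancelˡ′ : ∀ {i j k l} → i + k ≡ j + l → i ≡ j → k ≡ l
  +-cancelˡ′ {i} {k = k} {l} eq refl = +-cancelˡ-≡ i k l eq

  -- Directions `2F` and `3F` both lie in the planes where the sum of the coordinates is constant.
  sum-invariant : ∀ {p r s} → x p ≡ x r → t p + z p ≡ t r + z r → t r ≡ t s →
    x r + z r ≡ x s + z s → x p + (t p + z p) ≡ x s + (t s + z s)
  sum-invariant {p} {r} {s} x≡ tz t≡ xz = begin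
    x p + (t p + z p) ≡⟨ cong₂ _+_ x≡ tz ⟩
    x r + (t r + z r) ≡⟨ x∙yz≈y∙xz (x r) (t r) (z r) ⟩
    t r + (x r + z r) ≡⟨ cong₂ _+_ t≡ xz ⟩
    t s + (x s + z s) ≡⟨ x∙yz≈y∙xz (t s) (x s) (z s) ⟩
    x s + (t s + z s) ∎
    where open ≡-Reasoning

  two-lines : ∀ a b {p r} → True (a Fin.<? b) → SameLine a p r → SameLine b p r → p ≡ r
  two-lines 0F 1F _ (t , z)  (x , _)  = xtz-injective x t z
  two-lines 0F 2F _ (t , z)  (x , _)  = xtz-injective x t z
  two-lines 0F 3F _ (t , z)  (_ , xz) = xtz-injective (+-cancelʳ′ xz z) t z
  two-lines 1F 2F _ (x , z)  (_ , tz) = xtz-injective x (+-cancelʳ′ tz z) z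
  two-lines 1F 3F _ (x , z)  (t , _)  = xtz-injective x t z
  two-lines 2F 3F _ (x , tz) (t , _)  = xtz-injective x t (+-cancelˡ′ tz t)

  -- The displacement from `p` to `s` lies in the plane spanned by directions `a` and `b` and also
  -- along `c`, so linear independence makes it zero. Each clause solves one such linear system.
  three-lines : ∀ a b c {p r s} → True (a Fin.<? b) → False (a Fin.≟ c) → False (b Fin.≟ c) →
    SameLine a p r → SameLine b r s → SameLine c p s → p ≡ s
  three-lines 0F 1F 2F _ _ _ (t , z) (x , z′) (x″ , tz) =
    xtz-injective x″ (+-cancelʳ′ tz (trans z z′)) (trans z z′)
  three-lines 0F 1F 3F _ _ _ (t , z) (x , z′) (t″ , xz) =
    xtz-injective (+-cancelʳ′ xz (trans z z′)) t″ (trans z z′)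
  three-lines 0F 2F 1F _ _ _ (t , z) (x , tz) (x″ , z″) =
    xtz-injective x″ (+-cancelʳ′ (trans (cong₂ _+_ t z) tz) z″) z″
  three-lines 0F 2F 3F _ _ _ (t , z) (x , tz) (t″ , xz) = xtz-injective (+-cancelʳ′ xz z″) t″ z″
    where z″ = +-cancelˡ′ (trans (cong₂ _+_ t z) tz) t″
  three-lines 0F 3F 1F _ _ _ (t , z) (t′ , xz) (x″ , z″) = xtz-injective x″ (trans t t′) z″
  three-lines 0F 3F 2F _ _ _ (t , z) (t′ , xz) (x″ , tz) =
    xtz-injective x″ (trans t t′) (+-cancelˡ′ tz (trans t t′))
  three-lines 1F 2F 0F _ _ _ (x , z) (x′ , tz) (t″ , z″) = xtz-injective (trans x x′) t″ z″
  three-lines 1F 2F 3F _ _ _ (x , z) (x′ , tz) (t″ , xz) =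
    xtz-injective (trans x x′) t″ (+-cancelˡ′ xz (trans x x′))
  three-lines 1F 3F 0F _ _ _ (x , z) (t , xz) (t″ , z″) =
    xtz-injective (+-cancelʳ′ (trans (cong₂ _+_ x z) xz) z″) t″ z″
  three-lines 1F 3F 2F _ _ _ (x , z) (t , xz) (x″ , tz) = xtz-injective x″ (+-cancelʳ′ tz z″) z″
    where z″ = +-cancelˡ′ (trans (cong₂ _+_ x z) xz) x″
  three-lines 2F 3F 0F _ _ _ (x , tz) (t , xz) (t″ , z″) =
    xtz-injective (+-cancelʳ′ (sum-invariant x tz t xz) (cong₂ _+_ t″ z″)) t″ z″
  three-lines 2F 3F 1F _ _ _ (x , tz) (t , xz) (x″ , z″) =
    xtz-injective x″ (+-cancelʳ′ (+-cancelˡ′ (sum-invariant x tz t xz) x″) z″) z″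
  three-lines 0F 3F 3F _ _ ()
  three-lines 1F 3F 3F _ _ ()
  three-lines 2F 3F 2F _ ()
  three-lines 2F 3F 3F _ _ ()

  distinct-two-lines : ∀ a b {p r} → a ≢ b → SameLine a p r → SameLine b p r → p ≡ r
  distinct-two-lines a b a≢b pr pr′ with Fin.<-cmp a b
  ... | tri< a<b _ _ = two-lines a b (fromWitness a<b) pr pr′
  ... | tri≈ _ a≡b _ = contradiction a≡b a≢b
  ... | tri> _ _ b<a = two-lines b a (fromWitness b<a) pr′ pr

  no-triangle : ∀ {a b c p r s} → a ≢ c → b ≢ c →
    line a p ≡ line a r → line b r ≡ line b s → line c s ≡ line c p → s ≡ p
  no-triangle {a} {b} {c} {p} {r} {s} a≢c b≢c pr rs sp with Fin.<-cmp a b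
  ... | tri< a<b _ _ = sym (three-lines a b c (fromWitness a<b) (fromWitnessFalse a≢c)
    (fromWitnessFalse b≢c) (sameLine a pr) (sameLine b rs) (sameLine c (sym sp)))
  -- The first two sides merge into one line, leaving two lines of distinct directions.
  ... | tri≈ _ refl _ = sym (distinct-two-lines a c a≢c (sameLine a (trans pr rs)) (sameLine c (sym sp)))
  -- The triangle is traversed backwards.
  ... | tri> _ _ b<a = three-lines b a c (fromWitness b<a) (fromWitnessFalse b≢c)
    (fromWitnessFalse a≢c) (sameLine b (sym rs)) (sameLine a (sym pr)) (sameLine c sp)

-- The sequence of digraphs.

-- A cycle in class `j` has a first vertex, whose old colour maps to `j`; classes of new colours
-- thus need no separate case.
diColourable-mono : ∀ {D k l} → k ≤ l → DiColourable D k → DiColourable D l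
diColourable-mono k≤l (col , acyclic) = (λ u → Fin.inject≤ (col u) k≤l) , λ j (cycle , in-j) →
  acyclic (col (DirectedCycle.c cycle zero)) (cycle , λ i →
    Fin.inject≤-injective k≤l k≤l _ _ (trans (in-j i) (sym (in-j zero))))

-- The side q = c · B with c = 128 k makes the number of thresholds 8 q² k B equal to q³ / 16.
uncolourable-grid : ∀ k c → 1 ≤ k → c ≡ 128 * k →
  Σ Digraph λ D → ¬ DiColourable D k × (∀ v → NbhdFourTournaments D v) × ¬ HasCyclicTriangle D
uncolourable-grid k c 1≤k c≡128k =
  let h , ¬colourable = uncolourable
        (codes<labellings k c (q * (q * q)) (4 * (q * (q + q)) * k * c ^ 7) 1≤k k<c q³≡c²⁴ q³≡16N)
  in digraph h , ¬colourable , four-tournaments h , no-cyclic-triangle h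
  where
  q = c ^ 8
  open Grid q
  open LabelledNet line no-triangle {c ^ 7}
  k<c : k < c
  k<c = subst (k <_) (sym c≡128k)
    (subst (_< 128 * k) (*-identityˡ k) (*-monoˡ-< k {{>-nonZero 1≤k}} (m≤m+n 2 126)))
  q³≡c²⁴ : q * (q * q) ≡ c ^ 24
  q³≡c²⁴ = trans (cong (q *_) (sym (^-distribˡ-+-* c 8 8))) (sym (^-distribˡ-+-* c 8 16))
  q³≡16N : q * (q * q) ≡ 16 * (4 * (q * (q + q)) * k * c ^ 7)
  q³≡16N = trans (cong (λ x → q * (q * (x * c ^ 7))) c≡128k) (sym (cube-size k q (c ^ 7)))

theorem2p3 : Σ (ℕ → Digraph) λ F → ((∀ (k : ℕ) → Σ ℕ λ N → ∀ (n : ℕ) → N ≤ n → ¬ DiColourable (F n) k)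
    × (∀ (n : ℕ) (v : V (F n)) → NbhdFourTournaments (F n) v)
    × (∀ (n : ℕ) → ¬ HasCyclicTriangle (F n)))
theorem2p3 = proj₁ ∘ F
  , (λ k → k , λ n k≤n colourable →
      proj₁ (proj₂ (F n)) (diColourable-mono (m≤n⇒m≤1+n k≤n) colourable))
  , (λ n → proj₁ (proj₂ (proj₂ (F n))))
  , (λ n → proj₂ (proj₂ (proj₂ (F n))))
  where
  -- The shift to `suc n` colours provides the positive number of colours required even at `n = 0`.
  F : ∀ n → Σ Digraph λ D →
    ¬ DiColourable D (suc n) × (∀ v → NbhdFourTournaments D v) × ¬ HasCyclicTriangle D
  F n = uncolourable-grid (suc n) (128 * suc n) (s≤s z≤n) refl
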